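{- $\mathrm{HGP}(B_{2,3})=\mathrm{HGP}(B_{2,4})=7$, and $\mathrm{HGP}(B_{2,n})\le n+3$ for every $n\ge 4$. Moreover, $\mathrm{HGP}(B_{2,n})\ge 8$ for every $n\ge 6$.
   Context: Proper hat-guessing game: let $G=(V,E)$ be a finite simple graph and $[q]=\{0,1,\dots,q-1\}$. Before play, the vertices agree on deterministic guess functions; the guess of each vertex is a function of the colors on its open neighborhood, with values in $[q]$. An adversary assigns a color from $[q]$ to every vertex so that adjacent vertices get distinct colors (a proper $q$-coloring). All vertices simultaneously guess their own colors. A strategy (family of guess functions) is winning with $q$ colors if for every proper $q$-coloring at least one vertex guesses its own color correctly. The proper hat-guessing number $\mathrm{HGP}(G)$ is the largest $q$ for which a winning strategy exists. The book graph is $B_{k,n}=K_k\vee\overline{K_n}$ (join): $k$ mutually adjacent vertices (spines) and $n$ pairwise nonadjacent vertices (pages), every page adjacent to every spine. -}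

module Defs where

open import Data.Empty using (⊥)
open import Data.Fin using (Fin)
open import Data.Fin.Properties using (_≟_; +↔⊎)
open import Data.Nat using (ℕ; _+_; _≤_)
open import Data.Product using (Σ; ∃; _×_; proj₁)
open import Data.Sum using (_⊎_; inj₁; inj₂)
open import Data.Sum.Function.Propositional using (_⊎-↔_)
open import Data.Unit using (⊤; tt)
open import Function using (_∘_)
open import Function.Bundles using (Func; _↔_; _⟶ₛ_)
open import Function.Construct.Identity using (↔-id)
open import Function.Properties.Inverse using (↔-sym; ↔-trans)
open import Level using (0ℓ)
open import Relation.Binary using (Rel; Symmetric; Irreflexive; Decidable)
open import Relation.Binary.PropositionalEquality
  using (_≡_; _≢_; refl; ≢-sym; setoid; _→-setoid_)
open import Relation.Nullary using (yes; no; ¬?)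

-- The edge set of a finite graph is a finite set; constructively this makes
-- adjacency decidable, hence the field _~?_.
record FiniteSimpleGraph : Set₁ where
  field
    Vertex   : Set
    order    : ℕ
    finite   : Vertex ↔ Fin order
    _~_      : Rel Vertex 0ℓ
    _~?_     : Decidable _~_
    ~-sym    : Symmetric _~_
    ~-irrefl : Irreflexive _≡_ _~_

  Neighbour : Vertex → Set
  Neighbour v = Σ Vertex (v ~_)

module Game (G : FiniteSimpleGraph) where
  open FiniteSimpleGraph G

  Colouring : ℕ → Set
  Colouring q = Vertex → Fin q

  Proper : ∀ {q} → Colouring q → Set
  Proper c = ∀ v w → v ~ w → c v ≢ c w

  -- A guess depends only on the colours seen on the open neighbourhood.  As
  -- function extensionality is not available, a guess function is a setoid
  -- morphism: pointwise equal views must receive equal guesses.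
  GuessFunction : ℕ → Vertex → Set
  GuessFunction q v = (Neighbour v →-setoid Fin q) ⟶ₛ setoid (Fin q)

  Strategy : ℕ → Set
  Strategy q = ∀ v → GuessFunction q v

  guess : ∀ {q} → Strategy q → Colouring q → Colouring q
  guess s c v = Func.to (s v) (c ∘ proj₁)

  Winning : ∀ {q} → Strategy q → Set
  Winning s = ∀ c → Proper c → ∃ λ v → guess s c v ≡ c v

  Winnable : ℕ → Set
  Winnable q = ∃ λ (s : Strategy q) → Winning s

-- IsHGP G h: HGP(G) = h.  Given as a relation, because defining a function would first
-- require a proof that a largest q exists.
IsHGP : FiniteSimpleGraph → ℕ → Set
IsHGP G h = Winnable h × (∀ q → Winnable q → q ≤ h)
  where open Game G

complete : ℕ → FiniteSimpleGraph
complete k = record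
  { Vertex   = Fin k
  ; order    = k
  ; finite   = ↔-id (Fin k)
  ; _~_      = _≢_
  ; _~?_     = λ i j → ¬? (i ≟ j)
  ; ~-sym    = ≢-sym
  ; ~-irrefl = λ i≡j i≢j → i≢j i≡j
  }

edgeless : ℕ → FiniteSimpleGraph
edgeless n = record
  { Vertex   = Fin n
  ; order    = n
  ; finite   = ↔-id (Fin n)
  ; _~_      = λ _ _ → ⊥
  ; _~?_     = λ _ _ → no λ ()
  ; ~-sym    = λ ()
  ; ~-irrefl = λ _ ()
  }

module _ (G H : FiniteSimpleGraph) where
  private
    module G = FiniteSimpleGraph G
    module H = FiniteSimpleGraph H

  JoinAdj : Rel (G.Vertex ⊎ H.Vertex) 0ℓ
  JoinAdj (inj₁ u) (inj₁ v) = u G.~ v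
  JoinAdj (inj₁ _) (inj₂ _) = ⊤
  JoinAdj (inj₂ _) (inj₁ _) = ⊤
  JoinAdj (inj₂ u) (inj₂ v) = u H.~ v

  private
    adj? : Decidable JoinAdj
    adj? (inj₁ u) (inj₁ v) = u G.~? v
    adj? (inj₁ _) (inj₂ _) = yes tt
    adj? (inj₂ _) (inj₁ _) = yes tt
    adj? (inj₂ u) (inj₂ v) = u H.~? v

    adj-sym : Symmetric JoinAdj
    adj-sym {inj₁ _} {inj₁ _} e = G.~-sym e
    adj-sym {inj₁ _} {inj₂ _} _ = tt
    adj-sym {inj₂ _} {inj₁ _} _ = tt
    adj-sym {inj₂ _} {inj₂ _} e = H.~-sym e

    adj-irrefl : Irreflexive _≡_ JoinAdj
    adj-irrefl {inj₁ _} refl e = G.~-irrefl refl e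
    adj-irrefl {inj₂ _} refl e = H.~-irrefl refl e

  join : FiniteSimpleGraph
  join = record
    { Vertex   = G.Vertex ⊎ H.Vertex
    ; order    = G.order + H.order
    ; finite   = ↔-trans (G.finite ⊎-↔ H.finite) (↔-sym +↔⊎)
    ; _~_      = JoinAdj
    ; _~?_     = adj?
    ; ~-sym    = λ {u} {v} → adj-sym {u} {v}
    ; ~-irrefl = λ {u} {v} → adj-irrefl {u} {v}
    }

-- k spines (left summand) and n pages (right summand).
book : ℕ → ℕ → FiniteSimpleGraph
book k n = join (complete k) (edgeless n)

{-# OPTIONS --safe #-}
module Submission where

-- Fix the colours c of the pages. The spine colourings (x , y) that are proper and on which every
-- page errs are the edges of a bipartite graph between the values of x and those of y. The spines
-- can handle them iff every edge can be charged to one of its ends, no end being charged twice.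
--
-- Upper bound: give page 0 the colour b and all other pages the colour a. At most 2(q − 1) edges
-- survive if a = b and at most 2(q − 2) otherwise, so at most 2q(q − 1)² over all (a , b). On the
-- other hand, for each of the q(q − 1) pairs x ≢ y, a page colour is bad only if it is x, y or a
-- guess, which leaves at least (q − n − 1)(q − 3) choices of (a , b). This is impossible when q ≥ 8
-- and q ≥ n + 4.
--
-- Lower bounds: the pages guess x + t (y − x) over the field with q elements, with t = 2, 3, 4 for
-- q = 7 and with all t ∉ {0, 1} for q = 8; the charging is found by exhaustive search.

open import Defs
open import Data.Bool using (Bool; true; false; T; T?; _∧_; _∨_; _xor_; if_then_else_)
open import Data.Bool.Properties using (T-∧; T-∨)
open import Data.Fin using (Fin; zero; suc; toℕ; funToFin; finToFun)
open import Data.Fin.Patterns using (0F; 1F)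
open import Data.Fin.Properties using (_≟_; all?; any?; finToFun-funToFin)
open import Data.List as List using (List; []; _∷_; allFin; cartesianProduct; filter; length)
open import Data.List.Membership.DecPropositional as DecMembership using ()
open import Data.List.Membership.Propositional using (_∈_; _∉_)
open import Data.List.Membership.Propositional.Properties
  using (∈-allFin; ∈-cartesianProduct⁺; ∈-filter⁺; ∈-map⁺; ∈-tabulate⁺)
open import Data.List.Properties using (length-tabulate)
open import Data.List.Relation.Unary.Any using (here; there)
open import Data.Nat using (ℕ; zero; suc; _+_; _*_; _∸_; _^_; _≤_; _<_; z≤n; s≤s; _≤′_; ≤′-reflexive; ≤′-step)
open import Data.Nat.DivMod using (_mod_)
open import Data.Nat.GeneralisedArithmetic using (fold)
open import Data.Nat.Properties hiding (_≟_)
open import Data.Nat.Tactic.RingSolver using (solve-∀)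
open import Data.Product using (∃; ∃₂; _×_; _,_; proj₁; proj₂; map₂)
open import Data.Sum as Sum using (_⊎_; inj₁; inj₂)
open import Data.Vec as Vec using (Vec; []; _∷_; lookup)
open import Data.Vec.Functional using (updateAt)
open import Data.Vec.Functional.Properties using (updateAt-minimal; updateAt-updates)
open import Data.Vec.Properties using (lookup∘tabulate; tabulate-cong)
open import Function using (_∘_; const; id)
open import Function.Bundles using (Equivalence; Func)
open import Relation.Binary.PropositionalEquality
open import Relation.Nullary using (Dec; yes; no; ¬_; ¬?; does; contradiction; map′)
open import Relation.Nullary.Decidable using (toWitness; ⌊_⌋; _×-dec_; _⊎-dec_; _→-dec_)
open import Algebra.Properties.Semiring.Sum +-*-semiring
  using (sum; sum-syntax; sum-cong-≗; sum-replicate-zero; ∑-distrib-+; ∑-comm; *-distribˡ-sum; *-distribʳ-sum)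

record Survives {n q} (f : Fin n → Fin q → Fin q → Fin q) (c : Fin n → Fin q) (x y : Fin q) : Set where
  constructor survives
  field
    x≢y : x ≢ y
    c≢x : ∀ i → c i ≢ x
    c≢y : ∀ i → c i ≢ y
    f≢c : ∀ i → f i x y ≢ c i

-- The edge `(x , y)` is charged to `y` when `g y ≡ x` and to `x` when `h x ≡ y`; as `g` and `h` are
-- functions, no end is charged twice.
Covers : ∀ {n q} → (Fin n → Fin q → Fin q → Fin q) → (Fin n → Fin q) → (g h : Fin q → Fin q) → Set
Covers f c g h = ∀ x y → Survives f c x y → g y ≡ x ⊎ h x ≡ y

-- f: guesses of the pages; g, h: guesses of the first and of the second spine.
Solvable : ℕ → ℕ → Set
Solvable n q = ∃ λ (f : Fin n → Fin q → Fin q → Fin q) → ∀ c → ∃₂ λ g h → Covers f c g h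

-- From the game to covers

module _ {n q : ℕ} where
  open Game (book 2 n)

  colouring : Fin q → Fin q → (Fin n → Fin q) → Colouring q
  colouring x y c (inj₁ 0F) = x
  colouring x y c (inj₁ 1F) = y
  colouring x y c (inj₂ i)  = c i

  colouring-proper : ∀ {x y c} → x ≢ y → (∀ i → c i ≢ x) → (∀ i → c i ≢ y) → Proper (colouring x y c)
  colouring-proper x≢y c≢x c≢y (inj₁ 0F) (inj₁ 0F) u~v = contradiction refl u~v
  colouring-proper x≢y c≢x c≢y (inj₁ 0F) (inj₁ 1F) _   = x≢y
  colouring-proper x≢y c≢x c≢y (inj₁ 1F) (inj₁ 0F) _   = ≢-sym x≢y
  colouring-proper x≢y c≢x c≢y (inj₁ 1F) (inj₁ 1F) u~v = contradiction refl u~v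
  colouring-proper x≢y c≢x c≢y (inj₁ 0F) (inj₂ i)  _   = ≢-sym (c≢x i)
  colouring-proper x≢y c≢x c≢y (inj₁ 1F) (inj₂ i)  _   = ≢-sym (c≢y i)
  colouring-proper x≢y c≢x c≢y (inj₂ i)  (inj₁ 0F) _   = c≢x i
  colouring-proper x≢y c≢x c≢y (inj₂ i)  (inj₁ 1F) _   = c≢y i

  solvable⇒winnable : Solvable n q → Winnable q
  solvable⇒winnable (f , solve) = s , wins
    where
    g h : (Fin n → Fin q) → Fin q → Fin q
    -- `solve` may treat pointwise equal page colourings differently. Passing `c` through a vector
    -- gives them one common representative, as the `cong` fields below require.
    g c = proj₁ (solve (lookup (Vec.tabulate c)))
    h c = proj₁ (proj₂ (solve (lookup (Vec.tabulate c))))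

    g-cong : ∀ {c c′ y y′} → c ≗ c′ → y ≡ y′ → g c y ≡ g c′ y′
    g-cong c≗c′ refl rewrite tabulate-cong c≗c′ = refl

    h-cong : ∀ {c c′ x x′} → c ≗ c′ → x ≡ x′ → h c x ≡ h c′ x′
    h-cong c≗c′ refl rewrite tabulate-cong c≗c′ = refl

    s : Strategy q
    s (inj₁ 0F) = record
      { to   = λ view → g (λ i → view (inj₂ i , _)) (view (inj₁ 1F , λ ()))
      ; cong = λ eq → g-cong (λ i → eq _) (eq _) }
    s (inj₁ 1F) = record
      { to   = λ view → h (λ i → view (inj₂ i , _)) (view (inj₁ 0F , λ ()))
      ; cong = λ eq → h-cong (λ i → eq _) (eq _) }
    s (inj₂ i) = record
      { to   = λ view → f i (view (inj₁ 0F , _)) (view (inj₁ 1F , _))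
      ; cong = λ eq → cong₂ (f i) (eq _) (eq _) }

    wins : Winning s
    wins c proper with any? (λ i → f i (c (inj₁ 0F)) (c (inj₁ 1F)) ≟ c (inj₂ i))
    ... | yes (i , correct) = inj₂ i , correct
    ... | no  ¬correct      = Sum.[ (λ e → inj₁ 0F , e) , (λ e → inj₁ 1F , e) ]′
      (proj₂ (proj₂ (solve c′)) _ _ (survives
        (proper (inj₁ 0F) (inj₁ 1F) λ ())
        (λ i → proper (inj₂ i) (inj₁ 0F) _ ∘ trans (sym (c′≗ i)))
        (λ i → proper (inj₂ i) (inj₁ 1F) _ ∘ trans (sym (c′≗ i)))
        (λ i e → ¬correct (i , trans e (c′≗ i)))))
      where
      c′ = lookup (Vec.tabulate (c ∘ inj₂))
      c′≗ : c′ ≗ c ∘ inj₂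
      c′≗ = lookup∘tabulate (c ∘ inj₂)

  winnable⇒solvable : Winnable q → Solvable n q
  winnable⇒solvable (s , wins) = f , λ c → g c , h c , covers c
    where
    f : Fin n → Fin q → Fin q → Fin q
    -- A page does not see the pages, nor a spine itself, so the colours put there are fillers;
    -- these colourings need not be proper, since only guesses are read off.
    f i x y = guess s (colouring x y (const x)) (inj₂ i)

    g h : (Fin n → Fin q) → Fin q → Fin q
    g c y = guess s (colouring y y c) (inj₁ 0F)
    h c x = guess s (colouring x x c) (inj₁ 1F)

    covers : ∀ c → Covers f c (g c) (h c)
    covers c x y (survives x≢y c≢x c≢y f≢c)
      with wins (colouring x y c) (colouring-proper x≢y c≢x c≢y)
    ... | inj₁ 0F , correct = inj₁ (trans (Func.cong (s (inj₁ 0F)) λ where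
            (inj₁ 0F , 0≢0) → contradiction refl 0≢0
            (inj₁ 1F , _)   → refl
            (inj₂ _  , _)   → refl) correct)
    ... | inj₁ 1F , correct = inj₂ (trans (Func.cong (s (inj₁ 1F)) λ where
            (inj₁ 0F , _)   → refl
            (inj₁ 1F , 1≢1) → contradiction refl 1≢1
            (inj₂ _  , _)   → refl) correct)
    ... | inj₂ i  , correct = contradiction (trans (Func.cong (s (inj₂ i)) λ where
            (inj₁ 0F , _) → refl
            (inj₁ 1F , _) → refl) correct) (f≢c i)

-- Deciding solvability by finite search

-- Coded functions come back only pointwise equal to the originals, so covers have to transfer along
-- pointwise equality.
covers-resp : ∀ {n q} {f f′ : Fin n → Fin q → Fin q → Fin q} {c c′ : Fin n → Fin q} {g g′ h h′ : Fin q → Fin q} →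
  (∀ i x y → f i x y ≡ f′ i x y) → c ≗ c′ → g ≗ g′ → h ≗ h′ → Covers f c g h → Covers f′ c′ g′ h′
covers-resp f≗ c≗ g≗ h≗ covers x y (survives x≢y c≢x c≢y f≢c) = Sum.map (trans (sym (g≗ y))) (trans (sym (h≗ x)))
  (covers x y (survives x≢y
    (λ i → c≢x i ∘ trans (sym (c≗ i)))
    (λ i → c≢y i ∘ trans (sym (c≗ i)))
    (λ i e → f≢c i (trans (sym (f≗ i x y)) (trans e (c≗ i))))))

module _ {n q : ℕ} where
  covers? : ∀ (f : Fin n → Fin q → Fin q → Fin q) c g h → Dec (Covers f c g h)
  covers? f c g h = all? λ x → all? λ y → survives? x y →-dec (g y ≟ x ⊎-dec h x ≟ y)
    where
    survives? : ∀ x y → Dec (Survives f c x y)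
    survives? x y = map′ (λ (a , b , c , d) → survives a b c d) (λ (survives a b c d) → a , b , c , d)
      (¬? (x ≟ y) ×-dec all? (λ i → ¬? (c i ≟ x)) ×-dec all? (λ i → ¬? (c i ≟ y))
        ×-dec all? (λ i → ¬? (f i x y ≟ c i)))

  decode : Fin (((q ^ q) ^ q) ^ n) → Fin n → Fin q → Fin q → Fin q
  decode k i x = finToFun (finToFun (finToFun k i) x)

  encode : (Fin n → Fin q → Fin q → Fin q) → Fin (((q ^ q) ^ q) ^ n)
  encode f = funToFin λ i → funToFin λ x → funToFin (f i x)

  decode-encode : ∀ f i x y → decode (encode f) i x y ≡ f i x y
  decode-encode f i x y =
    trans (cong (λ k → finToFun (finToFun k x) y) (finToFun-funToFin (λ i → funToFin λ x → funToFin (f i x)) i))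
    (trans (cong (λ k → finToFun k y) (finToFun-funToFin (λ x → funToFin (f i x)) x))
    (finToFun-funToFin (f i x) y))

  -- Functions are searched through their codes, as the function types themselves are not known to be finite.
  SolvableCode : Set
  SolvableCode = ∃ λ k → ∀ c → ∃₂ λ g h → Covers (decode k) (finToFun c) (finToFun {q} {q} g) (finToFun {q} {q} h)

  code⇒solvable : SolvableCode → Solvable n q
  code⇒solvable (k , solve) = decode k , λ c →
    let (g , h , covers) = solve (funToFin c) in
    finToFun g , finToFun h ,
    covers-resp (λ _ _ _ → refl) (finToFun-funToFin c) (λ _ → refl) (λ _ → refl) covers

  solvable⇒code : Solvable n q → SolvableCode
  solvable⇒code (f , solve) = encode f , λ c →
    let (g , h , covers) = solve (finToFun c) in
    funToFin g , funToFin h ,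
    covers-resp (λ i x y → sym (decode-encode f i x y)) (λ _ → refl)
      (λ y → sym (finToFun-funToFin g y)) (λ x → sym (finToFun-funToFin h x)) covers

  -- Feeds `∃-largest`: with an upper bound at hand, deciding each `q` yields the largest winnable
  -- one.
  solvable? : Dec (Solvable n q)
  solvable? = map′ code⇒solvable solvable⇒code
    (any? λ k → all? λ c → any? λ g → any? λ h → covers? (decode k) (finToFun c) (finToFun g) (finToFun h))

-- Adding pages

-- A new page only deletes survivors, so the old spine guesses still cover, whatever it guesses.
solvable-suc : ∀ {n q} → Solvable n q → Solvable (suc n) q
solvable-suc (f , solve) = (λ { zero x _ → x ; (suc i) → f i }) , λ c →
  let (g , h , covers) = solve (c ∘ suc) in
  g , h , λ x y (survives x≢y c≢x c≢y f≢c) → covers x y (survives x≢y (c≢x ∘ suc) (c≢y ∘ suc) (f≢c ∘ suc))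

solvable-mono : ∀ {m n q} → m ≤ n → Solvable m q → Solvable n q
solvable-mono m≤n solvable = extend (≤⇒≤′ m≤n)
  where
  extend : ∀ {n} → _ ≤′ n → Solvable n _
  extend (≤′-reflexive refl) = solvable
  extend (≤′-step m≤′n)      = solvable-suc (extend m≤′n)

-- Upper bound

_∉?_ : ∀ {q} (x : Fin q) (X : List (Fin q)) → Dec (x ∉ X)
_∉?_ = DecMembership._∉?_ _≟_

𝟙 : ∀ {P : Set} → Dec P → ℕ
𝟙 P? = if does P? then 1 else 0

𝟙-yes : ∀ {P : Set} (P? : Dec P) → P → 𝟙 P? ≡ 1
𝟙-yes (yes _) _ = refl
𝟙-yes (no ¬p) p = contradiction p ¬p

𝟙-≤ : ∀ {P : Set} (P? : Dec P) {k} → (P → 1 ≤ k) → 𝟙 P? ≤ k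
𝟙-≤ (yes p) 1≤k = 1≤k p
𝟙-≤ (no _)  _   = z≤n

𝟙*-≤ : ∀ {P : Set} (P? : Dec P) {m k} → (P → m ≤ k) → 𝟙 P? * m ≤ k
𝟙*-≤ (yes p) {m} m≤k = ≤-trans (≤-reflexive (*-identityˡ m)) (m≤k p)
𝟙*-≤ (no _)  _   = z≤n

𝟙-+-¬ : ∀ {P : Set} (P? : Dec P) → 𝟙 P? + 𝟙 (¬? P?) ≡ 1
𝟙-+-¬ (yes _) = refl
𝟙-+-¬ (no _)  = refl

sum-mono-≤ : ∀ {n} {f g : Fin n → ℕ} → (∀ i → f i ≤ g i) → sum f ≤ sum g
sum-mono-≤ {zero}  f≤g = z≤n
sum-mono-≤ {suc n} f≤g = +-mono-≤ (f≤g zero) (sum-mono-≤ (f≤g ∘ suc))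

sum-const : ∀ n k → ∑[ i < n ] k ≡ n * k
sum-const zero    k = refl
sum-const (suc n) k = cong (k +_) (sum-const n k)

∑-𝟙-≟ : ∀ {n} (i : Fin n) → ∑[ j < n ] 𝟙 (i ≟ j) ≡ 1
∑-𝟙-≟ {suc n} zero    = cong suc (sum-replicate-zero n)
∑-𝟙-≟ {suc n} (suc i) = ∑-𝟙-≟ i

∑-𝟙-≢ : ∀ {p} (i : Fin (suc p)) → ∑[ j < suc p ] 𝟙 (¬? (i ≟ j)) ≡ p
∑-𝟙-≢ {p} i = suc-injective (begin
  1 + ∑[ j < suc p ] 𝟙 (¬? (i ≟ j))
    ≡⟨ cong (_+ ∑[ j < suc p ] 𝟙 (¬? (i ≟ j))) (∑-𝟙-≟ i) ⟨
  ∑[ j < suc p ] 𝟙 (i ≟ j) + ∑[ j < suc p ] 𝟙 (¬? (i ≟ j))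
    ≡⟨ ∑-distrib-+ (λ j → 𝟙 (i ≟ j)) (λ j → 𝟙 (¬? (i ≟ j))) ⟨
  ∑[ j < suc p ] (𝟙 (i ≟ j) + 𝟙 (¬? (i ≟ j)))
    ≡⟨ sum-cong-≗ (λ j → 𝟙-+-¬ (i ≟ j)) ⟩
  ∑[ j < suc p ] 1
    ≡⟨ sum-const (suc p) 1 ⟩
  suc p * 1
    ≡⟨ *-identityʳ (suc p) ⟩
  suc p ∎)
  where open ≡-Reasoning

-- Each entry rules out at most one colour; entries may repeat, hence the inequality.
∑-𝟙-∉ : ∀ {q} (L : List (Fin q)) → q ≤ ∑[ a < q ] 𝟙 (a ∉? L) + length L
∑-𝟙-∉ {q} [] = ≤-reflexive (sym (trans (+-identityʳ _) (trans (sum-const q 1) (*-identityʳ q))))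
∑-𝟙-∉ {q} (l ∷ L) = begin
  q
    ≤⟨ ∑-𝟙-∉ L ⟩
  ∑[ a < q ] 𝟙 (a ∉? L) + length L
    ≤⟨ +-monoˡ-≤ (length L) (sum-mono-≤ step) ⟩
  ∑[ a < q ] (𝟙 (a ∉? (l ∷ L)) + 𝟙 (l ≟ a)) + length L
    ≡⟨ cong (_+ length L) (∑-distrib-+ (λ a → 𝟙 (a ∉? (l ∷ L))) (λ a → 𝟙 (l ≟ a))) ⟩
  ∑[ a < q ] 𝟙 (a ∉? (l ∷ L)) + ∑[ a < q ] 𝟙 (l ≟ a) + length L
    ≡⟨ cong (λ k → ∑[ a < q ] 𝟙 (a ∉? (l ∷ L)) + k + length L) (∑-𝟙-≟ l) ⟩
  ∑[ a < q ] 𝟙 (a ∉? (l ∷ L)) + 1 + length L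
    ≡⟨ +-assoc _ 1 (length L) ⟩
  ∑[ a < q ] 𝟙 (a ∉? (l ∷ L)) + length (l ∷ L) ∎
  where
  open ≤-Reasoning
  step : ∀ a → 𝟙 (a ∉? L) ≤ 𝟙 (a ∉? (l ∷ L)) + 𝟙 (l ≟ a)
  step a with l ≟ a
  ... | yes _  = 𝟙-≤ (a ∉? L) (λ _ → m≤n+m 1 _)
  ... | no l≢a = 𝟙-≤ (a ∉? L) λ a∉L → ≤-trans
    (≤-reflexive (sym (𝟙-yes (a ∉? (l ∷ L)) λ { (here a≡l) → l≢a (sym a≡l) ; (there a∈L) → a∉L a∈L })))
    (m≤m+n _ 0)

∑∑-* : ∀ {m n} k (f : Fin m → ℕ) (g : Fin n → ℕ) →
  ∑[ i < m ] ∑[ j < n ] (k * (f i * g j)) ≡ k * (sum f * sum g)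
∑∑-* {m} {n} k f g = begin
  ∑[ i < m ] ∑[ j < n ] (k * (f i * g j))
    ≡⟨ sum-cong-≗ (λ i → trans (cong (k *_) (*-distribˡ-sum (f i) g)) (*-distribˡ-sum k (λ j → f i * g j))) ⟨
  ∑[ i < m ] (k * (f i * sum g))
    ≡⟨ *-distribˡ-sum k (λ i → f i * sum g) ⟨
  k * ∑[ i < m ] (f i * sum g)
    ≡⟨ cong (k *_) (*-distribʳ-sum (sum g) f) ⟨
  k * (sum f * sum g) ∎
  where open ≡-Reasoning

-- Double counting over two-tone page colourings

module _ {m p} (f : Fin (suc m) → Fin (suc p) → Fin (suc p) → Fin (suc p)) where
  private
    q = suc p

  two-tone : Fin q → Fin q → Fin (suc m) → Fin q
  two-tone a b zero    = b
  two-tone a b (suc _) = a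

  forbidden : Fin q → Fin q → List (Fin q)
  forbidden x y = x ∷ y ∷ List.tabulate (λ i → f (suc i) x y)

  forbidden₀ : Fin q → Fin q → List (Fin q)
  forbidden₀ x y = x ∷ y ∷ f zero x y ∷ []

  -- A product of indicators, so that for fixed `x` and `y` the sums over `a` and `b` separate.
  survivor : (a b x y : Fin q) → ℕ
  survivor a b x y = 𝟙 (¬? (x ≟ y)) * (𝟙 (a ∉? forbidden x y) * 𝟙 (b ∉? forbidden₀ x y))

  unused : (a b z : Fin q) → ℕ
  unused a b z = 𝟙 (¬? (z ≟ a)) * 𝟙 (¬? (z ≟ b))

  two-tone-survives : ∀ {a b x y} → x ≢ y → a ∉ forbidden x y → b ∉ forbidden₀ x y → Survives f (two-tone a b) x y
  two-tone-survives x≢y a∉ b∉ = survives x≢y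
    (λ { zero → b∉ ∘ here ; (suc _) → a∉ ∘ here })
    (λ { zero → b∉ ∘ there ∘ here ; (suc _) → a∉ ∘ there ∘ here })
    (λ { zero eq → b∉ (there (there (here (sym eq))))
       ; (suc i) refl → a∉ (there (there (∈-tabulate⁺ i))) })

  -- No edge counted by `survivor` has an end coloured `a` or `b`, so only ends avoiding both
  -- colours need to be charged.
  survivor-≤ : ∀ {a b g h} → Covers f (two-tone a b) g h → ∀ x y →
    survivor a b x y ≤ unused a b y * 𝟙 (g y ≟ x) + unused a b x * 𝟙 (h x ≟ y)
  survivor-≤ {a} {b} {g} {h} covers x y =
    𝟙*-≤ (¬? (x ≟ y)) λ x≢y → 𝟙*-≤ (a ∉? forbidden x y) λ a∉ → 𝟙-≤ (b ∉? forbidden₀ x y) λ b∉ →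
    let unused-x = cong₂ _*_ (𝟙-yes (¬? (x ≟ a)) (a∉ ∘ here ∘ sym)) (𝟙-yes (¬? (x ≟ b)) (b∉ ∘ here ∘ sym))
        unused-y = cong₂ _*_ (𝟙-yes (¬? (y ≟ a)) (a∉ ∘ there ∘ here ∘ sym)) (𝟙-yes (¬? (y ≟ b)) (b∉ ∘ there ∘ here ∘ sym))
    in Sum.[ (λ gy≡x → ≤-trans (≤-reflexive (sym (cong₂ _*_ unused-y (𝟙-yes (g y ≟ x) gy≡x)))) (m≤m+n _ _))
           , (λ hx≡y → ≤-trans (≤-reflexive (sym (cong₂ _*_ unused-x (𝟙-yes (h x ≟ y) hx≡y)))) (m≤n+m _ _))
           ]′ (covers x y (two-tone-survives x≢y a∉ b∉))

  ∑-guessed : ∀ (u : Fin q → ℕ) (g : Fin q → Fin q) → ∑[ y < q ] ∑[ x < q ] (u y * 𝟙 (g y ≟ x)) ≡ sum u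
  ∑-guessed u g = sum-cong-≗ λ y →
    trans (sym (*-distribˡ-sum (u y) (λ x → 𝟙 (g y ≟ x)))) (trans (cong (u y *_) (∑-𝟙-≟ (g y))) (*-identityʳ (u y)))

  ∑-survivor-≤ : ∀ {a b g h} → Covers f (two-tone a b) g h →
    ∑[ x < q ] ∑[ y < q ] survivor a b x y ≤ sum (unused a b) + sum (unused a b)
  ∑-survivor-≤ {a} {b} {g} {h} covers = begin
    ∑[ x < q ] ∑[ y < q ] survivor a b x y
      ≤⟨ sum-mono-≤ (λ x → sum-mono-≤ (survivor-≤ covers x)) ⟩
    ∑[ x < q ] ∑[ y < q ] (U x y + V x y)
      ≡⟨ sum-cong-≗ (λ x → ∑-distrib-+ (U x) (V x)) ⟩
    ∑[ x < q ] (sum (U x) + sum (V x))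
      ≡⟨ ∑-distrib-+ (sum ∘ U) (sum ∘ V) ⟩
    ∑[ x < q ] sum (U x) + ∑[ x < q ] sum (V x)
      ≡⟨ cong₂ _+_ (trans (∑-comm U) (∑-guessed (unused a b) g)) (∑-guessed (unused a b) h) ⟩
    sum (unused a b) + sum (unused a b) ∎
    where
    open ≤-Reasoning
    U V : Fin q → Fin q → ℕ
    U x y = unused a b y * 𝟙 (g y ≟ x)
    V x y = unused a b x * 𝟙 (h x ≟ y)

  -- For a fixed `z`, each of `a` and `b` independently has `p` values other than `z`; moving the
  -- sum over `z` outermost avoids a case split on `a ≡ b`.
  ∑-unused : ∑[ a < q ] ∑[ b < q ] sum (unused a b) ≡ q * (p * p)
  ∑-unused = begin
    ∑[ a < q ] ∑[ b < q ] ∑[ z < q ] unused a b z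
      ≡⟨ sum-cong-≗ (λ a → ∑-comm (unused a)) ⟩
    ∑[ a < q ] ∑[ z < q ] ∑[ b < q ] unused a b z
      ≡⟨ ∑-comm (λ a z → ∑[ b < q ] unused a b z) ⟩
    ∑[ z < q ] ∑[ a < q ] ∑[ b < q ] unused a b z
      ≡⟨ sum-cong-≗ (λ z → trans
           (sum-cong-≗ λ a → sum-cong-≗ λ b → sym (*-identityˡ (unused a b z)))
           (trans (∑∑-* 1 (λ a → 𝟙 (¬? (z ≟ a))) (λ b → 𝟙 (¬? (z ≟ b))))
           (trans (*-identityˡ _) (cong₂ _*_ (∑-𝟙-≢ z) (∑-𝟙-≢ z))))) ⟩
    ∑[ z < q ] (p * p)
      ≡⟨ sum-const q (p * p) ⟩
    q * (p * p) ∎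
    where open ≡-Reasoning

  -- `forbidden x y` has `m + 2` entries and `forbidden₀ x y` has 3, so each of the `q * p` pairs
  -- `x ≢ y` is counted for at least `k` choices of `a` times `l` choices of `b`.
  ∑-survivor-≥ : ∀ k l → q ≡ k + suc (suc m) → q ≡ l + 3 →
    q * (p * (k * l)) ≤ ∑[ a < q ] ∑[ b < q ] ∑[ x < q ] ∑[ y < q ] survivor a b x y
  ∑-survivor-≥ k l q≡k+m+2 q≡l+3 = begin
    q * (p * (k * l))
      ≡⟨ sum-const q (p * (k * l)) ⟨
    ∑[ x < q ] (p * (k * l))
      ≡⟨ sum-cong-≗ (λ (x : Fin q) → cong (_* (k * l)) (∑-𝟙-≢ x)) ⟨
    ∑[ x < q ] ((∑[ y < q ] 𝟙 (¬? (x ≟ y))) * (k * l))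
      ≡⟨ sum-cong-≗ (λ (x : Fin q) → *-distribʳ-sum (k * l) (λ y → 𝟙 (¬? (x ≟ y)))) ⟩
    ∑[ x < q ] ∑[ y < q ] (𝟙 (¬? (x ≟ y)) * (k * l))
      ≤⟨ sum-mono-≤ (λ x → sum-mono-≤ λ y → *-monoʳ-≤ (𝟙 (¬? (x ≟ y))) (*-mono-≤ (k≤ x y) (l≤ x y))) ⟩
    ∑[ x < q ] ∑[ y < q ] (𝟙 (¬? (x ≟ y)) * (∑[ a < q ] 𝟙 (a ∉? forbidden x y) * ∑[ b < q ] 𝟙 (b ∉? forbidden₀ x y)))
      ≡⟨ sum-cong-≗ (λ x → sum-cong-≗ λ y →
           ∑∑-* (𝟙 (¬? (x ≟ y))) (λ a → 𝟙 (a ∉? forbidden x y)) (λ b → 𝟙 (b ∉? forbidden₀ x y))) ⟨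
    ∑[ x < q ] ∑[ y < q ] ∑[ a < q ] ∑[ b < q ] survivor a b x y
      ≡⟨ sum-cong-≗ (λ x → ∑-comm (λ y a → ∑[ b < q ] survivor a b x y)) ⟩
    ∑[ x < q ] ∑[ a < q ] ∑[ y < q ] ∑[ b < q ] survivor a b x y
      ≡⟨ ∑-comm (λ x a → ∑[ y < q ] ∑[ b < q ] survivor a b x y) ⟩
    ∑[ a < q ] ∑[ x < q ] ∑[ y < q ] ∑[ b < q ] survivor a b x y
      ≡⟨ sum-cong-≗ (λ a → sum-cong-≗ λ x → ∑-comm (λ y b → survivor a b x y)) ⟩
    ∑[ a < q ] ∑[ x < q ] ∑[ b < q ] ∑[ y < q ] survivor a b x y
      ≡⟨ sum-cong-≗ (λ a → ∑-comm (λ x b → ∑[ y < q ] survivor a b x y)) ⟩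
    ∑[ a < q ] ∑[ b < q ] ∑[ x < q ] ∑[ y < q ] survivor a b x y ∎
    where
    open ≤-Reasoning
    k≤ : ∀ x y → k ≤ ∑[ a < q ] 𝟙 (a ∉? forbidden x y)
    k≤ x y = +-cancelʳ-≤ (length (forbidden x y)) _ _ (≤-trans
      (≤-reflexive (trans (cong (λ n → k + suc (suc n)) (length-tabulate (λ i → f (suc i) x y))) (sym q≡k+m+2)))
      (∑-𝟙-∉ (forbidden x y)))
    l≤ : ∀ x y → l ≤ ∑[ b < q ] 𝟙 (b ∉? forbidden₀ x y)
    l≤ x y = +-cancelʳ-≤ 3 _ _ (≤-trans (≤-reflexive (sym q≡l+3)) (∑-𝟙-∉ (forbidden₀ x y)))

¬solvable : ∀ {m q} → 8 ≤ q → m + 5 ≤ q → ¬ Solvable (suc m) q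
¬solvable {m} 8≤q m+5≤q (f , solve) with m≤n⇒∃[o]m+o≡n 8≤q | m≤n⇒∃[o]m+o≡n m+5≤q
-- With `q = 8 + r = m + 5 + s`, the counts are `k = 3 + s` and `l = 5 + r`. Cancelling `q` and `p`
-- leaves `k * l ≤ 2 * p`, yet `15 + 3 * r` exceeds `14 + 2 * r`. At `q = 7` and `k = 3` both sides
-- would be 12.
... | r , refl | s , m+5+s≡q = n≮n (2 * p) (begin-strict
  2 * p
    <⟨ 2p< r ⟩
  3 * (5 + r)
    ≤⟨ *-monoˡ-≤ (5 + r) (m≤m+n 3 s) ⟩
  (3 + s) * (5 + r)
    ≤⟨ *-cancelˡ-≤ p (*-cancelˡ-≤ q total) ⟩
  2 * p ∎)
  where
  open ≤-Reasoning
  p = 7 + r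
  q = suc p
  2p< : ∀ r → 2 * (7 + r) < 3 * (5 + r)
  2p< r = ≤-trans (m≤m+n _ r) (≤-reflexive (lemma r))
    where
    lemma : ∀ r → suc (2 * (7 + r)) + r ≡ 3 * (5 + r)
    lemma = solve-∀
  total : q * (p * ((3 + s) * (5 + r))) ≤ q * (p * (2 * p))
  total = begin
    q * (p * ((3 + s) * (5 + r)))
      ≤⟨ ∑-survivor-≥ f (3 + s) (5 + r) (trans (sym m+5+s≡q) (shift m s)) (+-comm 3 (5 + r)) ⟩
    ∑[ a < q ] ∑[ b < q ] ∑[ x < q ] ∑[ y < q ] survivor f a b x y
      ≤⟨ sum-mono-≤ (λ a → sum-mono-≤ λ b → ∑-survivor-≤ f (proj₂ (proj₂ (solve (two-tone f a b))))) ⟩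
    ∑[ a < q ] ∑[ b < q ] (sum (unused f a b) + sum (unused f a b))
      ≡⟨ sum-cong-≗ (λ a → ∑-distrib-+ (λ b → sum (unused f a b)) (λ b → sum (unused f a b))) ⟩
    ∑[ a < q ] (∑[ b < q ] sum (unused f a b) + ∑[ b < q ] sum (unused f a b))
      ≡⟨ ∑-distrib-+ (λ a → ∑[ b < q ] sum (unused f a b)) (λ a → ∑[ b < q ] sum (unused f a b)) ⟩
    ∑[ a < q ] ∑[ b < q ] sum (unused f a b) + ∑[ a < q ] ∑[ b < q ] sum (unused f a b)
      ≡⟨ cong₂ _+_ (∑-unused f) (∑-unused f) ⟩
    q * (p * p) + q * (p * p)
      ≡⟨ double q p ⟩
    q * (p * (2 * p)) ∎
    where
    shift : ∀ m s → m + 5 + s ≡ 3 + s + suc (suc m)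
    shift = solve-∀
    double : ∀ q p → q * (p * p) + q * (p * p) ≡ q * (p * (2 * p))
    double = solve-∀

-- Lower bounds

-- A surviving spine colouring, with the guesses on it of the pages whose colours are not yet fixed.
Edge : ℕ → ℕ → Set
Edge q n = Fin q × Fin q × Vec (Fin q) n

-- X and Y are the ends that are already charged.
orientable : ∀ {q n} (X Y : List (Fin q)) → List (Edge q n) → Bool
orientable X Y [] = true
orientable X Y ((x , y , _) ∷ E) =
  (⌊ x ∉? X ⌋ ∧ orientable (x ∷ X) Y E) ∨ (⌊ y ∉? Y ⌋ ∧ orientable X (y ∷ Y) E)

-- The induction needs the charged ends to lie outside `X` and `Y`: overwriting `h` at a newly
-- charged `x`, or `g` at a newly charged `y`, then leaves the cover of the remaining edges intact.
orientation : ∀ {q n} X Y (E : List (Edge q n)) → T (orientable X Y E) →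
  ∃₂ λ (g h : Fin q → Fin q) → ∀ {x y gs} → (x , y , gs) ∈ E →
    (y ∉ Y × g y ≡ x) ⊎ (x ∉ X × h x ≡ y)
orientation X Y [] _ = id , id , λ ()
orientation X Y ((x , y , _) ∷ E) t with Equivalence.to (T-∨ {⌊ x ∉? X ⌋ ∧ orientable (x ∷ X) Y E}) t
... | inj₁ tˣ with Equivalence.to (T-∧ {⌊ x ∉? X ⌋}) tˣ
...   | x∉X , o with orientation (x ∷ X) Y E o
...     | g , h , covers = g , updateAt h x (const y) , λ where
  (here refl) → inj₂ (toWitness {a? = x ∉? X} x∉X , updateAt-updates x h)
  (there e)   → Sum.map₂ (λ (x′∉ , hx′≡y′) →
    x′∉ ∘ there , trans (updateAt-minimal _ x h (x′∉ ∘ here)) hx′≡y′) (covers e)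
orientation X Y ((x , y , _) ∷ E) t | inj₂ tʸ with Equivalence.to (T-∧ {⌊ y ∉? Y ⌋}) tʸ
...   | y∉Y , o with orientation X (y ∷ Y) E o
...     | g , h , covers = updateAt g y (const x) , h , λ where
  (here refl) → inj₁ (toWitness {a? = y ∉? Y} y∉Y , updateAt-updates y g)
  (there e)   → Sum.map₁ (λ (y′∉ , gy′≡x′) →
    y′∉ ∘ there , trans (updateAt-minimal _ y g (y′∉ ∘ here)) gy′≡x′) (covers e)

Avoids : ∀ {q n} → Fin q → Edge q (suc n) → Set
Avoids a (x , y , gs) = a ≢ x × a ≢ y × Vec.head gs ≢ a

avoids? : ∀ {q n} (a : Fin q) (e : Edge q (suc n)) → Dec (Avoids a e)
avoids? a (x , y , gs) = ¬? (a ≟ x) ×-dec ¬? (a ≟ y) ×-dec ¬? (Vec.head gs ≟ a)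

reveal : ∀ {q n} → Fin q → List (Edge q (suc n)) → List (Edge q n)
reveal a = List.map (map₂ (map₂ Vec.tail)) ∘ filter (avoids? a)

-- Fixing more pages only deletes edges, so a branch ends as soon as its graph is orientable.
settled : ∀ {q n} → List (Edge q n) → Bool
settled {n = zero}  E = orientable [] [] E
settled {n = suc n} E = orientable [] [] E ∨ ⌊ all? (λ a → T? (settled (reveal a E))) ⌋

Guesses : ∀ {q n} → List (Edge q n) → (Fin n → Fin q) → Set
Guesses {q} E c = ∃₂ λ (g h : Fin q → Fin q) → ∀ {x y gs} → (x , y , gs) ∈ E →
    (∀ i → c i ≢ x) → (∀ i → c i ≢ y) → (∀ i → lookup gs i ≢ c i) → g y ≡ x ⊎ h x ≡ y

orientable⇒guesses : ∀ {q n} (E : List (Edge q n)) → T (orientable [] [] E) → (c : Fin n → Fin q) → Guesses E c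
orientable⇒guesses E o c with orientation [] [] E o
... | g , h , covers = g , h , λ e _ _ _ → Sum.map proj₂ proj₂ (covers e)

-- The spines see every page, so `g` and `h` may depend on the branch chosen by `c zero`; the edges
-- that `reveal` deletes do not survive that page.
settled⇒guesses : ∀ {q n} (E : List (Edge q n)) → T (settled E) → (c : Fin n → Fin q) → Guesses E c
settled⇒guesses {n = zero} E s c = orientable⇒guesses E s c
settled⇒guesses {n = suc n} E s c with Equivalence.to (T-∨ {orientable [] [] E}) s
... | inj₁ o = orientable⇒guesses E o c
... | inj₂ t with settled⇒guesses (reveal (c zero) E) (toWitness {a? = all? (λ a → T? (settled (reveal a E)))} t (c zero)) (c ∘ suc)
... | g , h , covers = g , h , λ {_} {_} {gs} e c≢x c≢y gs≢c →
  covers (∈-map⁺ _ (∈-filter⁺ (avoids? (c zero)) e (c≢x zero , c≢y zero , subst (_≢ c zero) (lookup-head gs) (gs≢c zero))))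
    (c≢x ∘ suc) (c≢y ∘ suc) (λ i → subst (_≢ c (suc i)) (lookup-tail gs i) (gs≢c (suc i)))
  where
  lookup-head : ∀ {q n} (gs : Vec (Fin q) (suc n)) → lookup gs zero ≡ Vec.head gs
  lookup-head (_ ∷ _) = refl
  lookup-tail : ∀ {q n} (gs : Vec (Fin q) (suc n)) i → lookup gs (suc i) ≡ lookup (Vec.tail gs) i
  lookup-tail (_ ∷ _) i = refl

edges : ∀ {q n} → (Fin n → Fin q → Fin q → Fin q) → List (Edge q n)
edges {q} f = List.map (λ (x , y) → x , y , Vec.tabulate (λ i → f i x y))
  (filter (λ (x , y) → ¬? (x ≟ y)) (cartesianProduct (allFin q) (allFin q)))

settled⇒solvable : ∀ {n q} (f : Fin n → Fin q → Fin q → Fin q) → T (settled (edges f)) → Solvable n q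
settled⇒solvable f s = f , λ c → let (g , h , covers) = settled⇒guesses _ s c in
  g , h , λ x y (survives x≢y c≢x c≢y f≢c) →
    covers (∈-map⁺ _ (∈-filter⁺ (λ (x , y) → ¬? (x ≟ y)) (∈-cartesianProduct⁺ (∈-allFin x) (∈-allFin y)) x≢y))
      c≢x c≢y (λ i → subst (_≢ c i) (sym (lookup∘tabulate _ i)) (f≢c i))

-- x + t (y − x) = (1 − t) x + t y with t = i + 2, where 1 − t is taken mod 7 as 6 − i.
affine₇ : Fin 3 → Fin 7 → Fin 7 → Fin 7
affine₇ i x y = ((6 ∸ toℕ i) * toℕ x + (2 + toℕ i) * toℕ y) mod 7

solvable-3-7 : Solvable 3 7
-- Type checking runs the search: `T (settled (edges affine₇))` reduces to the unit type, whose
-- element fills `_`.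
solvable-3-7 = settled⇒solvable affine₇ _

-- The field 𝔽₂[α] with α³ = α + 1, in the basis 1, α, α².
F₈ : Set
F₈ = Bool × Bool × Bool

fromF₈ : F₈ → Fin 8
fromF₈ (a , b , c) = (bit a + 2 * bit b + 4 * bit c) mod 8
  where
  bit : Bool → ℕ
  bit b = if b then 1 else 0

toF₈ : Fin 8 → F₈
toF₈ = lookup
  ((false , false , false) ∷ (true , false , false) ∷ (false , true , false) ∷ (true , true , false) ∷
   (false , false , true)  ∷ (true , false , true)  ∷ (false , true , true)  ∷ (true , true , true)  ∷ [])

_⊕_ : F₈ → F₈ → F₈
(a , b , c) ⊕ (a′ , b′ , c′) = a xor a′ , b xor b′ , c xor c′

-- Since α³ = α + 1, multiplying a + bα + cα² by α gives c + (a + c)α + bα².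
α· : F₈ → F₈
α· (a , b , c) = c , a xor c , b

-- x + t (y − x) with t = αⁱ⁺¹.
affine₈ : Fin 6 → Fin 8 → Fin 8 → Fin 8
affine₈ i x y = fromF₈ (toF₈ x ⊕ fold (toF₈ x ⊕ toF₈ y) α· (suc (toℕ i)))

solvable-6-8 : Solvable 6 8
solvable-6-8 = settled⇒solvable affine₈ _

-- The proper hat-guessing number

-- Descends from the bound `b` to the first value satisfying `P`; the witness `w` keeps the descent
-- from failing at 0.
∃-largest : ∀ {P : ℕ → Set} → (∀ q → Dec (P q)) → ∀ {w} → P w → ∀ b → (∀ q → P q → q ≤ b) →
  ∃ λ h → P h × (∀ q → P q → q ≤ h)
∃-largest P? Pw b bounded with P? b
... | yes Pb = b , Pb , bounded
∃-largest P? {w} Pw zero bounded | no ¬P0 with n≤0⇒n≡0 (bounded w Pw)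
... | refl = contradiction Pw ¬P0
∃-largest P? Pw (suc b) bounded | no ¬Psb = ∃-largest P? Pw b λ q Pq →
  ≤-pred (≤∧≢⇒< (bounded q Pq) λ { refl → ¬Psb Pq })

open Game using (Winnable)

-- With `n = m + 1` pages, a `q` above `h` would satisfy both `8 ≤ q` and `n + 4 ≤ q`.
winnable-≤ : ∀ {m h} → 7 ≤ h → m + 4 ≤ h → ∀ q → Winnable (book 2 (suc m)) q → q ≤ h
winnable-≤ {m} {h} 7≤h m+4≤h q w = ≮⇒≥ λ h<q → ¬solvable
  (≤-trans (s≤s 7≤h) h<q) (≤-trans (≤-reflexive (+-suc m 4)) (≤-trans (s≤s m+4≤h) h<q)) (winnable⇒solvable w)

winnable-mono : ∀ {m n q} → m ≤ n → Solvable m q → Winnable (book 2 n) q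
winnable-mono m≤n = solvable⇒winnable ∘ solvable-mono m≤n

hgp : ∀ {n} → 4 ≤ n → ∃ λ h → IsHGP (book 2 n) h × h ≤ n + 3
hgp {n@(suc m)} 4≤n =
  let (h , w , largest) = ∃-largest (λ q → map′ solvable⇒winnable winnable⇒solvable solvable?)
        (winnable-mono (≤-trans (n≤1+n 3) 4≤n) solvable-3-7) (n + 3) bounded
  in h , (w , largest) , bounded h w
  where
  bounded : ∀ q → Winnable (book 2 n) q → q ≤ n + 3
  bounded = winnable-≤ (+-monoˡ-≤ 3 4≤n) (≤-reflexive (+-suc m 3))

theorem1p3 : IsHGP (book 2 3) 7 × IsHGP (book 2 4) 7
    × (∀ (n : ℕ) → 4 ≤ n → ∃ λ h → IsHGP (book 2 n) h × h ≤ n + 3)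
    × (∀ (n : ℕ) → 6 ≤ n → ∃ λ h → IsHGP (book 2 n) h × 8 ≤ h)
theorem1p3 =
    -- The bound 7 applies as long as `n + 3 ≤ 7`, hence to both 3 and 4 pages.
    (winnable-mono (m≤m+n 3 0) solvable-3-7 , winnable-≤ (m≤m+n 7 0) (m≤m+n 6 1))
  , (winnable-mono (m≤m+n 3 1) solvable-3-7 , winnable-≤ (m≤m+n 7 0) (m≤m+n 7 0))
  , (λ n → hgp)
  , (λ n 6≤n → let (h , isHGP , _) = hgp (≤-trans (m≤m+n 4 2) 6≤n) in
      h , isHGP , proj₂ isHGP 8 (winnable-mono 6≤n solvable-6-8))
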